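{- Let $\mathbb{O}=(Q,\{Q_p\mid p\in\mathcal{P}\},\delta_0,\delta_{>0})$ be a one-counter process, let $k=|Q|$, let $K=\mathrm{LCM}([k])$ be the least common multiple of the numbers $1,\ldots,k$, and for every $\mathsf{CTL}$ formula $\varphi$ let $K_\varphi=K^{\mathrm{lud}(\varphi)}$, where $\mathrm{lud}(\varphi)$ is the leftward until depth of $\varphi$. Then for all $\mathsf{CTL}$ formulas $\varphi$, all $q\in Q$, and all $n,n'\in\mathbb{N}$ with $n,n'>2\cdot|\varphi|\cdot k^2\cdot K_\varphi$ and $n\equiv n' \bmod K_\varphi$: $$(q,n)\in[\![\varphi]\!]_{T(\mathbb{O})}\quad\Longleftrightarrow\quad (q,n')\in[\![\varphi]\!]_{T(\mathbb{O})}.$$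
   Context: $\mathbb{N}=\{0,1,2,\ldots\}$, $[k]=\{1,\ldots,k\}$. Fix a countable set $\mathcal{P}$ of propositions. Transition systems. A transition system is $T=(S,\{S_p\mid p\in\mathcal{P}\},\to)$ with state set $S$, $\to\,\subseteq S\times S$, and $S_p\subseteq S$ with $S_p=\emptyset$ for all but finitely many $p$. One-counter processes. A one-counter process (OCP) is $\mathbb{O}=(Q,\{Q_p\mid p\in\mathcal{P}\},\delta_0,\delta_{>0})$ with $Q$ a finite set of control locations, $Q_p\subseteq Q$ (empty for all but finitely many $p$), $\delta_0\subseteq Q\times\{0,1\}\times Q$ and $\delta_{>0}\subseteq Q\times\{ -1,0,1\}\times Q$. Its transition system is $T(\mathbb{O})=(Q\times\mathbb{N},\{Q_p\times\mathbb{N}\mid p\in\mathcal{P}\},\to)$, where $(q,n)\to(q',n+j)$ iff either $n=0$ and $(q,j,q')\in\delta_0$, or $n>0$ and $(q,j,q')\in\delta_{>0}$. $\mathsf{CTL}$. Formulas: $\varphi::=p\mid\neg\varphi\mid\varphi\wedge\varphi\mid\exists\mathsf{X}\varphi\mid\exists\varphi\mathsf{U}\varphi\mid\exists\varphi\mathsf{WU}\varphi$ with $p\in\mathcal{P}$. Semantics $[\![\varphi]\!]_T\subseteq S$: $[\![p]\!]_T=S_p$; negation and conjunction are complement and intersection; $[\![\exists\mathsf{X}\varphi]\!]_T=\{s\mid\exists s'\in[\![\varphi]\!]_T:s\to s'\}$; $[\![\exists\varphi_1\mathsf{U}\varphi_2]\!]_T$ is the set of $s$ for which there is a finite path $\pi_1\to\cdots\to\pi_l$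 ($l\ge1$) with $\pi_1=s$, $\pi_l\in[\![\varphi_2]\!]_T$, $\pi_i\in[\![\varphi_1]\!]_T$ for all $1\le i<l$; $[\![\exists\varphi_1\mathsf{WU}\varphi_2]\!]_T$ is the union of $[\![\exists\varphi_1\mathsf{U}\varphi_2]\!]_T$ with the set of $s$ from which there is an infinite path all of whose states (including $s$) are in $[\![\varphi_1]\!]_T$. Size: $|p|=1$, $|\neg\varphi|=|\exists\mathsf{X}\varphi|=|\varphi|+1$, $|\varphi_1\wedge\varphi_2|=|\exists\varphi_1\mathsf{U}\varphi_2|=|\exists\varphi_1\mathsf{WU}\varphi_2|=|\varphi_1|+|\varphi_2|+1$. Leftward until depth: $\mathrm{lud}(p)=0$, $\mathrm{lud}(\neg\varphi)=\mathrm{lud}(\exists\mathsf{X}\varphi)=\mathrm{lud}(\varphi)$, $\mathrm{lud}(\varphi_1\wedge\varphi_2)=\max\{\mathrm{lud}(\varphi_1),\mathrm{lud}(\varphi_2)\}$, $\mathrm{lud}(\exists\varphi_1\mathsf{U}\varphi_2)=\mathrm{lud}(\exists\varphi_1\mathsf{WU}\varphi_2)=\max\{\mathrm{lud}(\varphi_1)+1,\mathrm{lud}(\varphi_2)\}$. -}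

module Defs where

open import Data.Fin.Base using (Fin; zero; suc; inject₁; fromℕ)
open import Data.Integer.Base as ℤ using (ℤ; 0ℤ; 1ℤ; -1ℤ; +_)
open import Data.List.Base using (List; applyUpTo; foldr)
open import Data.List.Membership.Propositional using () renaming (_∉_ to _∉ˡ_)
open import Data.Nat.Base using (ℕ; suc; _+_; _*_; _^_; _⊔_; _>_; ∣_-_∣)
open import Data.Nat.Divisibility using (_∣_)
open import Data.Nat.LCM using (lcm)
open import Data.Product.Base using (_×_; _,_; proj₁; proj₂; Σ-syntax; ∃-syntax)
open import Data.Sum.Base using (_⊎_)
open import Function.Bundles using (_↔_)
open import Level using (0ℓ)
open import Relation.Binary.Core using (Rel)
open import Relation.Binary.PropositionalEquality.Core using (_≡_)
open import Relation.Unary using (Pred; _∈_; _∩_; _∪_; ∁; Empty)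

EmptyAlmostEverywhere : {P A : Set} → (P → Pred A 0ℓ) → Set
EmptyAlmostEverywhere {P} X = ∃[ ps ] (∀ (p : P) → p ∉ˡ ps → Empty (X p))

record TransitionSystem (P : Set) : Set₁ where
  field
    State        : Set
    label        : P → Pred State 0ℓ
    label-finite : EmptyAlmostEverywhere label
    _⟶_          : Rel State 0ℓ

-- The counter updates are integers, restricted by δ₀-range and δ₊-range
-- to {0,1} and {-1,0,1} respectively.
record OCP (P : Set) : Set₁ where
  field
    Q            : Set
    ∣Q∣          : ℕ
    Q-finite     : Q ↔ Fin ∣Q∣
    label        : P → Pred Q 0ℓ
    label-finite : EmptyAlmostEverywhere label
    δ₀           : Pred (Q × ℤ × Q) 0ℓ
    δ₀-range     : ∀ {q j q′} → (q , j , q′) ∈ δ₀ → j ≡ 0ℤ ⊎ j ≡ 1ℤ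
    δ₊           : Pred (Q × ℤ × Q) 0ℓ
    δ₊-range     : ∀ {q j q′} → (q , j , q′) ∈ δ₊ →
                   j ≡ -1ℤ ⊎ j ≡ 0ℤ ⊎ j ≡ 1ℤ

module _ {P : Set} where

  T : OCP P → TransitionSystem P
  T O = record
    { State        = Q × ℕ
    ; label        = λ p (q , _) → q ∈ label p
    ; label-finite = proj₁ label-finite ,
                     λ p p∉ps (q , _) → proj₂ label-finite p p∉ps q
    ; _⟶_          = λ (q , n) (q′ , n′) → ∃[ j ]
                       (+ n′ ≡ + n ℤ.+ j ×
                        ((n ≡ 0 × (q , j , q′) ∈ δ₀) ⊎
                         (n > 0 × (q , j , q′) ∈ δ₊)))
    }
    where open OCP O

data CTL (P : Set) : Set where
  prop    : P → CTL P
  ¬′_     : CTL P → CTL P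
  _∧′_    : CTL P → CTL P → CTL P
  ∃X_     : CTL P → CTL P
  ∃_U_    : CTL P → CTL P → CTL P
  ∃_WU_   : CTL P → CTL P → CTL P

module _ {P : Set} (𝒯 : TransitionSystem P) where
  open TransitionSystem 𝒯

  -- The path π 0 ⟶ ⋯ ⟶ π m has m + 1 ≥ 1 states; i : Fin m ranges over
  -- all of its positions but the last, inject₁ i being position i itself.
  Until : Pred State 0ℓ → Pred State 0ℓ → Pred State 0ℓ
  Until A B s = ∃[ m ] Σ[ π ∈ (Fin (suc m) → State) ]
    (π zero ≡ s ×
     (∀ (i : Fin m) → π (inject₁ i) ⟶ π (suc i)) ×
     (∀ (i : Fin m) → π (inject₁ i) ∈ A) ×
     π (fromℕ m) ∈ B)

  Forever : Pred State 0ℓ → Pred State 0ℓ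
  Forever A s = Σ[ π ∈ (ℕ → State) ]
    (π 0 ≡ s ×
     (∀ (i : ℕ) → π i ⟶ π (suc i)) ×
     (∀ (i : ℕ) → π i ∈ A))

  ⟦_⟧ : CTL P → Pred State 0ℓ
  ⟦ prop p ⟧   = label p
  ⟦ ¬′ φ ⟧     = ∁ ⟦ φ ⟧
  ⟦ φ ∧′ ψ ⟧   = ⟦ φ ⟧ ∩ ⟦ ψ ⟧
  ⟦ ∃X φ ⟧     = λ s → ∃[ s′ ] (s′ ∈ ⟦ φ ⟧ × s ⟶ s′)
  ⟦ ∃ φ U ψ ⟧  = Until ⟦ φ ⟧ ⟦ ψ ⟧
  ⟦ ∃ φ WU ψ ⟧ = Until ⟦ φ ⟧ ⟦ ψ ⟧ ∪ Forever ⟦ φ ⟧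

module _ {P : Set} where

  size : CTL P → ℕ
  size (prop p)   = 1
  size (¬′ φ)     = size φ + 1
  size (φ ∧′ ψ)   = size φ + size ψ + 1
  size (∃X φ)     = size φ + 1
  size (∃ φ U ψ)  = size φ + size ψ + 1
  size (∃ φ WU ψ) = size φ + size ψ + 1

  lud : CTL P → ℕ
  lud (prop p)   = 0
  lud (¬′ φ)     = lud φ
  lud (φ ∧′ ψ)   = lud φ ⊔ lud ψ
  lud (∃X φ)     = lud φ
  lud (∃ φ U ψ)  = (lud φ + 1) ⊔ lud ψ
  lud (∃ φ WU ψ) = (lud φ + 1) ⊔ lud ψ

LCM : List ℕ → ℕ
LCM = foldr lcm 1

[1⋯_] : ℕ → List ℕ
[1⋯ k ] = applyUpTo suc k

_≡_mod_ : ℕ → ℕ → ℕ → Set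
n ≡ n′ mod m = m ∣ ∣ n - n′ ∣

{-# OPTIONS --safe #-}
module Submission where

-- By induction on φ, truth of φ at (q , n) is periodic in n with period K_φ above
-- the bound; writing D = K_φ and M = K_{φ₁}, this is only hard for until formulas
-- ∃ φ₁ U φ₂. Take a path from (q , n). As long as it stays above the bound
-- for the subformulas, it may be shifted by D. If it comes down to that bound, then
-- by the pigeonhole principle every descent through k * M counter values contains
-- a loop from (r , c * M + m) to (r , m) with 1 ≤ c ≤ k, and moving such loops
-- preserves φ₁. To start D higher, repeat one loop D / (c * M) more times; to start
-- D lower, delete D / (c * M) loops with the same c. Both meet the
-- original path at the bound, after which it is followed unchanged.
--
-- Whether an infinite path ever comes down is undecidable. But after boundedly
-- many steps it has come down, or has climbed by k * M, or has repeated a state;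
-- in the last two cases it contains a loop from (r , m) to (r , c * M + m) with
-- c ≥ 0, and going round this loop forever gives an infinite path that never
-- comes down.

open import Data.Empty using (⊥-elim)
open import Data.Fin.Base using (Fin; zero; suc; toℕ; fromℕ; fromℕ<; inject₁; combine)
open import Data.Fin.Properties as Fin
  using (pigeonhole; combine-injective; toℕ-fromℕ<; toℕ<n; toℕ≤pred[n])
open import Data.Integer.Base as ℤ using (+_)
import Data.Integer.Properties as ℤ
open import Algebra.Properties.AbelianGroup ℤ.+-0-abelianGroup using (∙-cancelˡ)
open import Data.List.Base using (_∷_; applyUpTo)
open import Data.List.Membership.Propositional using () renaming (_∈_ to _∈ˡ_)
open import Data.List.Membership.Propositional.Properties using (∈-applyUpTo⁺)
open import Data.List.Relation.Unary.Any using (here; there)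
open import Data.Nat.Base
open import Data.Nat.Divisibility
  using (_∣_; divides; ∣-refl; ∣-trans; m∣m*n; n∣m*n; 0∣⇒≡0)
open import Data.Nat.LCM using (lcm; m∣lcm[m,n]; n∣lcm[m,n]; lcm-least)
open import Data.Nat.Properties
open import Data.Nat.Tactic.RingSolver using (solve-∀)
open import Data.Product.Base using (_×_; _,_; proj₁; proj₂; ∃; ∃-syntax; Σ-syntax)
open import Data.Product.Function.NonDependent.Propositional using (_×-⇔_)
open import Data.Sum.Base using (_⊎_; inj₁; inj₂) renaming (map to map-⊎)
open import Data.Vec.Functional using (updateAt)
open import Data.Vec.Functional.Properties using (updateAt-updates; updateAt-minimal)
open import Defs
open import Function.Base using (_∘_; id; flip)
open import Function.Bundles
  using (_↣_; _⇔_; mk⇔; module Equivalence; module Inverse; module Injection)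
open import Function.Construct.Composition using (_⇔-∘_)
open import Function.Construct.Identity using (⇔-id)
open import Function.Construct.Symmetry using (⇔-sym)
open import Function.Definitions using (Injective)
open import Function.Properties.Inverse using (↔⇒↣)
open import Function.Related.TypeIsomorphisms using (¬-cong-⇔)
open import Level using (0ℓ)
open import Relation.Binary.Construct.Closure.ReflexiveTransitive
  using (Star; ε; _◅_; _◅◅_; gmap; reverse; concat)
open import Relation.Binary.Core using (Rel; _=[_]⇒_)
open import Relation.Binary.PropositionalEquality
  using (_≡_; refl; sym; trans; cong; cong₂; subst; subst₂)
open import Relation.Nullary using (yes; no)
open import Relation.Unary using (Pred; _∈_)

open Equivalence using (to; from)

-- Finite and infinite paths of a relation.

split⁺ : {X : Set} {R : Rel X 0ℓ} {s t : X} → Star R s t →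
         s ≡ t ⊎ (∃[ u ] R s u × Star R u t)
split⁺ ε        = inj₁ refl
split⁺ (x ◅ xs) = inj₂ (_ , x , xs)

segment : {X : Set} {R : Rel X 0ℓ} (ρ : ℕ → X) {n i j : ℕ} →
          (∀ {m} → m < n → R (ρ m) (ρ (suc m))) →
          i ≤ j → j ≤ n → Star R (ρ i) (ρ j)
segment {R = R} ρ {n} {i} step i≤j = go (≤⇒≤′ i≤j)
  where
  go : ∀ {j} → i ≤′ j → j ≤ n → Star R (ρ i) (ρ j)
  go ≤′-refl       _   = ε
  go (≤′-step i≤j) j<n = go i≤j (<⇒≤ j<n) ◅◅ step j<n ◅ ε

record Infinite {X : Set} (R : Rel X 0ℓ) (s : X) : Set where
  constructor infinite
  field
    path  : ℕ → X
    start : path 0 ≡ s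
    steps : ∀ i → R (path i) (path (suc i))

uncons : {X : Set} {R : Rel X 0ℓ} {s : X} → Infinite R s → ∃[ u ] R s u × Infinite R u
uncons (infinite π refl steps) = π 1 , steps 0 , infinite (π ∘ suc) refl (steps ∘ suc)

-- The invariant is data, so each next state is computed from it and no choice principle is
-- involved.
unfold : {X : Set} {R : Rel X 0ℓ} (I : X → Set) →
         (∀ {s} → I s → ∃[ u ] R s u × I u) → ∀ {s} → I s → Infinite R s
unfold {X} {R} I next {s} Is =
  infinite (proj₁ ∘ state) refl (λ i → proj₁ (proj₂ (next (proj₂ (state i)))))
  where
  state : ℕ → ∃ I
  state zero    = s , Is
  state (suc i) = let u , _ , Iu = next (proj₂ (state i)) in u , Iu

prepend : {X : Set} {R : Rel X 0ℓ} {s t : X} → Star R s t → Infinite R t → Infinite R s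
prepend {R = R} {t = t} p rest = unfold I next (inj₁ p)
  where
  I = λ s → Star R s t ⊎ Infinite R s
  next : ∀ {s} → I s → ∃[ u ] R s u × I u
  next (inj₁ ε)        = next (inj₂ rest)
  next (inj₁ (x ◅ xs)) = _ , x , inj₁ xs
  next (inj₂ π)        = let u , x , π′ = uncons π in u , x , inj₂ π′

map-infinite : {X Y : Set} {R : Rel X 0ℓ} {S : Rel Y 0ℓ} (f : X → Y) → R =[ f ]⇒ S →
               ∀ {s} → Infinite R s → Infinite S (f s)
map-infinite f g (infinite π refl steps) = infinite (f ∘ π) refl (g ∘ steps)

-- Finite sums and a weighted pigeonhole principle.

total : ∀ {n} → (Fin n → ℕ) → ℕ
total {zero}  f = 0
total {suc n} f = f zero + total (f ∘ suc)

total-updateAt : ∀ {n} (f : Fin n → ℕ) (c : Fin n) → total (updateAt f c suc) ≡ suc (total f)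
total-updateAt f zero    = refl
total-updateAt f (suc c) =
  trans (cong (_+_ (f zero)) (total-updateAt (f ∘ suc) c)) (+-suc (f zero) _)

total-zero : ∀ n → total {n} (λ _ → 0) ≡ 0
total-zero zero    = refl
total-zero (suc n) = total-zero n

total-pigeonhole : ∀ {n} N (f : Fin n → ℕ) → n * N < total f → ∃[ c ] N < f c
total-pigeonhole {suc n} N f lt with N <? f zero
... | yes N<f₀ = zero , N<f₀
... | no  N≮f₀ =
  let c , N<fc = total-pigeonhole N (f ∘ suc)
                   (+-cancelˡ-< N _ _ (<-≤-trans lt (+-monoˡ-≤ _ (≮⇒≥ N≮f₀))))
  in suc c , N<fc

-- Loops in paths of a counter that changes by at most one per step.

module Counter {Q : Set} {k : ℕ} (index : Q → Fin k) (index-injective : Injective _≡_ _≡_ index)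
               (M : ℕ) where

  -- The loop climbs by `suc (toℕ height)` units of `M`, so the possible climbs are exactly 1 to `k`
  -- units. Descending loops are climbing loops of `flip R`.
  record Loop (R : Rel (Q × ℕ) 0ℓ) (s t : Q × ℕ) : Set where
    constructor loop
    field
      {height} : Fin k
      {state}  : Q
      {level}  : ℕ
      before   : Star R s (state , level)
      around   : Star R (state , level) (state , suc (toℕ height) * M + level)
      after    : Star R (state , suc (toℕ height) * M + level) t

  module Climb (R : Rel (Q × ℕ) 0ℓ) (R-slow : ∀ {s u} → R s u → proj₂ u ≤ suc (proj₂ s)) where

    cross : ∀ {p l q l′} m → l ≤ m → m ≤ l′ → Star R (p , l) (q , l′) →
            ∃[ r ] Star R (p , l) (r , m) × Star R (r , m) (q , l′)
    cross {l = l} m l≤m m≤l′ xs with l ≟ m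
    ... | yes refl = _ , ε , xs
    cross m l≤m m≤l′ ε | no l≢m = ⊥-elim (l≢m (≤-antisym l≤m m≤l′))
    cross m l≤m m≤l′ (x ◅ xs) | no l≢m =
      let r , ys , zs = cross m (≤-trans (R-slow x) (≤∧≢⇒< l≤m l≢m)) m≤l′ xs
      in r , x ◅ ys , zs

    regroup : ∀ i l → suc i * M + l ≡ i * M + (M + l)
    regroup i l = trans (cong (_+ l) (+-comm M (i * M))) (+-assoc (i * M) M l)

    -- A slow path cannot jump over a level, so it can be cut at a visit to each level `i * M + l`.
    -- The location `st 0` may differ from `p`, since for `j = 0` the path may wander before
    -- returning to level `l`.
    ladder : ∀ j {p q l} → Star R (p , l) (q , j * M + l) →
             Σ[ st ∈ (ℕ → Q) ] Star R (p , l) (st 0 , l) × st j ≡ q ×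
               (∀ {i} → i < j → Star R (st i , i * M + l) (st (suc i) , suc i * M + l))
    ladder zero {q = q} xs = (λ _ → q) , xs , refl , λ ()
    ladder (suc j) {p} {q} {l} xs
      with r , ys , zs ← cross (M + l) (m≤n+m l M) (+-monoˡ-≤ l (m≤m+n M (j * M))) xs
      with st , first , last , rungs ←
             ladder j (subst (λ m → Star R (r , M + l) (q , m)) (regroup j l) zs)
      = st′ , ε , last , rungs′
      where
      st′ : ℕ → Q
      st′ zero    = p
      st′ (suc i) = st i
      rungs′ : ∀ {i} → i < suc j → Star R (st′ i , i * M + l) (st′ (suc i) , suc i * M + l)
      rungs′ {zero} _ = subst (λ m → Star R (p , l) (st 0 , m)) (sym (regroup 0 l)) (ys ◅◅ first)
      rungs′ {suc i} (s≤s i<j) =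
        subst₂ (λ m m′ → Star R (st i , m) (st (suc i) , m′))
               (sym (regroup i l)) (sym (regroup (suc i) l)) (rungs i<j)

    -- The `k + 1` levels from `l` to `k * M + l`, spaced by `M`, are visited in only `k` control
    -- locations, so two of the chosen visits share one.
    ascending-loop : ∀ {p q l} → Star R (p , l) (q , k * M + l) →
                     Loop R (p , l) (q , k * M + l)
    ascending-loop {p} {q} {l} xs
      with st , first , refl , rungs ← ladder k xs
      with i , i′ , i<i′ , eq ← pigeonhole (n<1+n k) (index ∘ st ∘ toℕ)
      = loop {height = h} (first ◅◅ climb z≤n (≤-trans (<⇒≤ i<i′) i′≤k))
             (subst₂ (λ r m → Star R (st (toℕ i) , toℕ i * M + l) (r , m))
                     (sym (index-injective eq)) top (climb (<⇒≤ i<i′) i′≤k))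
             (subst₂ (λ r m → Star R (r , m) (st k , k * M + l))
                     (sym (index-injective eq)) top (climb i′≤k ≤-refl))
      where
      i′≤k : toℕ i′ ≤ k
      i′≤k = toℕ≤pred[n] i′
      climb : ∀ {a b} → a ≤ b → b ≤ k → Star R (st a , a * M + l) (st b , b * M + l)
      climb a≤b b≤k =
        concat (segment {R = Star R} (λ i → st i , i * M + l) rungs a≤b b≤k)
      height< : toℕ i′ ∸ suc (toℕ i) < k
      height< = subst (_≤ k) (+-∸-assoc 1 i<i′) (≤-trans (m∸n≤m (toℕ i′) (toℕ i)) i′≤k)
      h : Fin k
      h = fromℕ< height<
      top : toℕ i′ * M + l ≡ suc (toℕ h) * M + (toℕ i * M + l)
      top = trans (cong (λ x → x * M + l)
                        (trans (sym (m∸n+n≡m i<i′))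
                               (trans (+-suc _ (toℕ i))
                                      (cong (λ x → suc x + toℕ i) (sym (toℕ-fromℕ< height<))))))
                  (distribute (suc (toℕ h)) (toℕ i) M l)
        where
        distribute : ∀ a b M l → (a + b) * M + l ≡ a * M + (b * M + l)
        distribute = solve-∀

  module Descend (R : Rel (Q × ℕ) 0ℓ) (R-slow : ∀ {s u} → R s u → proj₂ s ≤ suc (proj₂ u)) where

    reversed : ∀ {s t} → Star R s t → Star (flip R) t s
    reversed = reverse id

    unreversed : ∀ {s t} → Star (flip R) t s → Star R s t
    unreversed = reverse id

    open Climb (flip R) R-slow

    descend-to : ∀ {p l q l′} m → l ≤ m → m ≤ l′ → Star R (q , l′) (p , l) →
                 ∃[ r ] Star R (q , l′) (r , m) × Star R (r , m) (p , l)
    descend-to m l≤m m≤l′ xs =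
      let r , ys , zs = cross m l≤m m≤l′ (reversed xs)
      in r , unreversed zs , unreversed ys

    descending-loop : ∀ {p q l} → Star R (q , k * M + l) (p , l) →
                      Loop (flip R) (p , l) (q , k * M + l)
    descending-loop xs = ascending-loop (reversed xs)

  raise : ℕ → Q × ℕ → Q × ℕ
  raise y (q , l) = q , y * M + l

  raise-raise : ∀ x y s → raise x (raise y s) ≡ raise (x + y) s
  raise-raise x y (q , l) = cong (q ,_) (regroup x y l)
    where
    regroup : ∀ x y l → x * M + (y * M + l) ≡ (x + y) * M + l
    regroup x y l = trans (sym (+-assoc (x * M) (y * M) l))
                          (cong (_+ l) (sym (*-distribʳ-+ M x y)))

  -- Inserting, deleting and iterating loops.

  module Pump (R : Rel (Q × ℕ) 0ℓ)
              (R-slow↑ : ∀ {s u} → R s u → proj₂ u ≤ suc (proj₂ s))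
              (R-slow↓ : ∀ {s u} → R s u → proj₂ s ≤ suc (proj₂ u))
              (R-raise : ∀ y {s u} → R s u → R (raise y s) (raise y u)) where

    open Climb R R-slow↑
    open Descend R R-slow↓

    raise-path : ∀ y {s t} → Star R s t → Star R (raise y s) (raise y t)
    raise-path y = gmap (raise y) (R-raise y)

    repeat : ∀ c {s} → Star R (raise c s) s → ∀ n → Star R (raise (n * c) s) s
    repeat c     xs zero    = ε
    repeat c {s} xs (suc n) =
      subst (λ u → Star R u (raise (n * c) s))
            (trans (raise-raise (n * c) c s) (cong (λ x → raise x s) (+-comm (n * c) c)))
            (raise-path (n * c) xs)
      ◅◅ repeat c xs n

    module _ (N : ℕ) (height∣N : ∀ (c : Fin k) → suc (toℕ c) ∣ N) where

      -- A descending loop is found in the last `k * M` levels. Everything before it is raised by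
      -- `N` units, and extra rounds of the loop absorb the difference.
      insert-loops : ∀ {q p l} → k * M ≤ l → Star R (q , l) (p , 0) →
                     Star R (q , N * M + l) (p , 0)
      insert-loops {q} {p} {l} kM≤l xs
        with r , first , rest ← descend-to (k * M + 0)
                                  z≤n (subst (_≤ l) (sym (+-identityʳ (k * M))) kM≤l) xs
        with loop {h} {state} {level} after around before ← descending-loop rest
        with divides n N≡nc ← height∣N h
        = raise-path N (first ◅◅ unreversed before)
          -- As `N` is `n * c`, exactly `n` extra rounds are needed.
          ◅◅ subst (λ x → Star R (raise x (raise c s)) (raise c s)) (sym N≡nc)
                   (repeat c (raise-path c (unreversed around)) n)
          ◅◅ unreversed around ◅◅ unreversed after
        where
        c = suc (toℕ h)
        s = state , level

      -- From s to t, up to j descending loops of height suc c (in units of M) can be left out,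
      -- each raising everything after it.
      Skip : Fin k → ℕ → Rel (Q × ℕ) 0ℓ
      Skip c j s t = ∀ {i} → i ≤ j → ∀ y → Star R (raise y s) (raise (i * suc (toℕ c) + y) t)

      skip-none : ∀ {c s t} → Star R s t → Skip c 0 s t
      skip-none xs z≤n y = raise-path y xs

      -- Of `i` loops to be left out, `j ⊓ i` are taken from the first part and the remaining
      -- `i ∸ j` from the second. The second part starts as high as the first has left it, which is
      -- why `Skip` quantifies over `y`.
      skip-trans : ∀ {c j j′ s t u} → Skip c j s t → Skip c j′ t u → Skip c (j + j′) s u
      skip-trans {c} {j} {j′} {s} {t} {u} f g {i} i≤j+j′ y =
        subst (λ x → Star R (raise y s) (raise x u)) amount
              (f (m⊓n≤m j i) y ◅◅ g (m≤n+o⇒m∸n≤o i j i≤j+j′) ((j ⊓ i) * C + y))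
        where
        C = suc (toℕ c)
        amount : (i ∸ j) * C + ((j ⊓ i) * C + y) ≡ i * C + y
        amount = trans (sym (+-assoc ((i ∸ j) * C) ((j ⊓ i) * C) y))
                   (cong (_+ y) (trans (sym (*-distribʳ-+ C (i ∸ j) (j ⊓ i)))
                     (cong (_* C) (trans (+-comm (i ∸ j) (j ⊓ i)) (m⊓n+n∸m≡n j i)))))

      -- Leaving out the loop joins the part before it to the part after it, the latter raised by
      -- the height of the loop.
      skip-loop : ∀ {p q l} → Star R (q , k * M + l) (p , l) →
                  ∃[ c ] Skip c 1 (q , k * M + l) (p , l)
      skip-loop {p} {q} {l} xs
        with loop {h} {state} {level} after _ before ← descending-loop xs
        = h , skip
        where
        C = suc (toℕ h)
        skip : Skip h 1 (q , k * M + l) (p , l)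
        skip z≤n       y = raise-path y xs
        skip (s≤s z≤n) y =
          raise-path y (unreversed before)
          ◅◅ subst (λ u → Star R u (raise (1 * C + y) (p , l)))
                   (trans (cong (λ x → raise x (state , level))
                                (trans (cong (_+ y) (*-identityˡ C)) (+-comm C y)))
                          (sym (raise-raise y C (state , level))))
                   (raise-path (1 * C + y) (unreversed after))

      -- The descent is cut into `B` blocks of `k * M` levels, each containing a loop; `f c` counts
      -- the blocks whose chosen loop has height `suc c`.
      skips : ∀ B {p q} → Star R (q , B * (k * M)) (p , 0) →
              Σ[ f ∈ (Fin k → ℕ) ] total f ≡ B × (∀ c → Skip c (f c) (q , B * (k * M)) (p , 0))
      skips zero    xs = (λ _ → 0) , total-zero k , λ c → skip-none xs
      skips (suc B) {p} {q} xs
        with r , top , rest ← descend-to (B * (k * M)) z≤n (m≤n+m _ (k * M)) xs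
        with f , total≡ , skip-rest ← skips B rest
        with c , skip-top ← skip-loop top
        = updateAt f c suc , trans (total-updateAt f c) (cong suc total≡) , skip
        where
        skip : ∀ c′ → Skip c′ (updateAt f c suc c′) _ _
        skip c′ with c′ Fin.≟ c
        ... | yes refl = subst (λ j → Skip c j _ _) (sym (updateAt-updates c f))
                               (skip-trans skip-top (skip-rest c))
        ... | no c′≢c  = subst (λ j → Skip c′ j _ _) (sym (updateAt-minimal c′ c f c′≢c))
                               (skip-trans (skip-none top) (skip-rest c′))

      -- Only loops of one common height `c` can be guaranteed to add up to exactly `N`: `N / c` of
      -- them are removed. With `k * N` blocks and `k` heights, some height occurs at least `N`
      -- times, which is enough.
      delete-loops : .{{NonZero N}} → ∀ {q p l} → k * N * (k * M) ≤ l → Star R (q , l) (p , 0) →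
                     Star R (q , l) (p , N * M)
      delete-loops {q} {p} {l} len xs
        with r , top , rest ← descend-to (k * N * (k * M)) z≤n len xs
        with f , total≡ , skip ← skips (k * N) rest
        -- The pigeonhole principle is strict, so it is applied with `pred N`: the total `k * N`
        -- exceeds `k * pred N`.
        with c , N≤fc ← total-pigeonhole (pred N) f
                          (subst (k * pred N <_) (sym total≡)
                            (*-monoʳ-< k {{Fin.nonZeroIndex (index q)}}
                              (m≤pred[n]⇒suc[m]≤n ≤-refl)))
        with divides n N≡nc ← height∣N c
        = top ◅◅ subst (λ m → Star R (r , k * N * (k * M)) (p , m)) level≡ (skip c n≤fc 0)
        where
        n≤fc : n ≤ f c
        n≤fc = ≤-trans (≤-trans (m≤m*n n (suc (toℕ c))) (≤-reflexive (sym N≡nc)))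
                       (subst (_≤ f c) (suc-pred N) N≤fc)
        level≡ : (n * suc (toℕ c) + 0) * M + 0 ≡ N * M
        level≡ = trans (+-identityʳ _) (cong (_* M) (trans (+-identityʳ _) (sym N≡nc)))

    -- Each round is the previous one raised by `y`; the invariant is a path to the start of the
    -- next round. The first step is given separately so that a round is never empty. The case
    -- `y = 0` is an ordinary cycle.
    lasso : ∀ {s u} y → R s u → Star R u (raise y s) → Infinite R s
    lasso {s} {u} y x xs = unfold I (λ (z , ys) → next z ys) (y , x ◅ xs)
      where
      I = λ v → ∃[ z ] Star R v (raise z s)
      next : ∀ {v} z → Star R v (raise z s) → ∃[ w ] R v w × I w
      next z (x′ ◅ ys) = _ , x′ , z , ys
      next z ε         = raise z u , R-raise z x , z + y ,
        subst (Star R (raise z u)) (raise-raise z y s) (raise-path z xs)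

    climb⇒infinite : .{{NonZero M}} → ∀ {q p l} →
                     Star R (q , l) (p , k * M + l) → Infinite R (q , l)
    climb⇒infinite xs with loop {h} {state} {level} before around _ ← ascending-loop xs
      with split⁺ around
    ... | inj₁ s≡t           = ⊥-elim (1+n≰n grow)
      where
      grow : suc level ≤ level
      grow = subst (suc level ≤_) (sym (cong proj₂ s≡t))
               (+-monoˡ-≤ level (≤-trans (>-nonZero⁻¹ M) (m≤m+n M (toℕ h * M))))
    ... | inj₂ (_ , y , ys) = prepend before (lasso (suc (toℕ h)) y ys)

    -- Below `h` there are `k * h` configurations, and `ρ` runs through at least `k * h + 1`, so one
    -- recurs and closes a lasso of height 0.
    bounded⇒infinite : ∀ h {n} (ρ : ℕ → Q × ℕ) →
                       (∀ {i} → i < n → R (ρ i) (ρ (suc i))) →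
                       (∀ {i} → i ≤ n → proj₂ (ρ i) < h) →
                       k * h ≤ n → Infinite R (ρ 0)
    bounded⇒infinite h {n} ρ step bound long
      with i , j , i<j , eq ← pigeonhole (s≤s long)
             (λ i → combine (index (proj₁ (ρ (toℕ i)))) (fromℕ< (bound (toℕ≤pred[n] i))))
      = prepend (segment ρ step z≤n (<⇒≤ (<-≤-trans i<j (toℕ≤pred[n] j))))
                (lasso 0 (step (<-≤-trans i<j (toℕ≤pred[n] j)))
                         (subst (Star R _) same (segment ρ step i<j (toℕ≤pred[n] j))))
      where
      injective = combine-injective (index (proj₁ (ρ (toℕ i)))) _ (index (proj₁ (ρ (toℕ j)))) _ eq
      same : ρ (toℕ j) ≡ ρ (toℕ i)
      same = sym (cong₂ _,_ (index-injective (proj₁ injective))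
               (trans (sym (toℕ-fromℕ< (bound (toℕ≤pred[n] i))))
                 (trans (cong toℕ (proj₂ injective)) (toℕ-fromℕ< (bound (toℕ≤pred[n] j))))))

-- Until and forever in terms of paths.

module _ {P : Set} (𝒯 : TransitionSystem P) where
  open TransitionSystem 𝒯

  Within : Pred State 0ℓ → Rel State 0ℓ
  Within A s u = s ∈ A × s ⟶ u

  until⇒star : ∀ {A B s} → s ∈ Until 𝒯 A B → ∃[ t ] Star (Within A) s t × t ∈ B
  until⇒star {A} {B} (m , π , refl , step , inA , last∈B) = go m π step inA last∈B
    where
    go : ∀ m (π : Fin (suc m) → State) → (∀ i → π (inject₁ i) ⟶ π (suc i)) →
         (∀ i → π (inject₁ i) ∈ A) → π (fromℕ m) ∈ B → ∃[ t ] Star (Within A) (π zero) t × t ∈ B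
    go zero    π step inA last∈B = _ , ε , last∈B
    go (suc m) π step inA last∈B =
      let t , xs , t∈B = go m (π ∘ suc) (step ∘ suc) (inA ∘ suc) last∈B
      in t , (inA zero , step zero) ◅ xs , t∈B

  star⇒until : ∀ {A B s t} → Star (Within A) s t → t ∈ B → s ∈ Until 𝒯 A B
  star⇒until {s = s} ε t∈B = 0 , (λ _ → s) , refl , (λ ()) , (λ ()) , t∈B
  star⇒until {A} {B} {s} ((s∈A , s⟶u) ◅ xs) t∈B
    with m , π , refl , step , inA , b ← star⇒until {A} {B} xs t∈B
    = suc m , π′ , refl , step′ , inA′ , b
    where
    π′ : Fin (suc (suc m)) → State
    π′ zero    = s
    π′ (suc i) = π i
    step′ : ∀ i → π′ (inject₁ i) ⟶ π′ (suc i)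
    step′ zero    = s⟶u
    step′ (suc i) = step i
    inA′ : ∀ i → π′ (inject₁ i) ∈ A
    inA′ zero    = s∈A
    inA′ (suc i) = inA i

  forever⇒infinite : ∀ {A s} → s ∈ Forever 𝒯 A → Infinite (Within A) s
  forever⇒infinite (π , start , step , inA) = infinite π start (λ i → inA i , step i)

  infinite⇒forever : ∀ {A s} → Infinite (Within A) s → s ∈ Forever 𝒯 A
  infinite⇒forever (infinite π start steps) = π , start , proj₂ ∘ steps , proj₁ ∘ steps

-- Eventually periodic sets of configurations.

Periodic : {Q : Set} → Pred (Q × ℕ) 0ℓ → ℕ → ℕ → Set
Periodic X b D = ∀ q {n} → b ≤ n → (q , n) ∈ X ⇔ (q , D + n) ∈ X

periodic-multiple : ∀ {Q} {X : Pred (Q × ℕ) 0ℓ} {b D} → Periodic X b D → ∀ e → Periodic X b (e * D)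
periodic-multiple         per zero    q b≤n = ⇔-id _
periodic-multiple {X = X} {D = D} per (suc e) q {n} b≤n =
  subst (λ m → X (q , n) ⇔ X (q , m)) (sym (+-assoc D (e * D) n))
    (per q (≤-trans b≤n (m≤n+m n (e * D))) ⇔-∘ periodic-multiple per e q b≤n)

periodic-weaken : ∀ {Q} {X : Pred (Q × ℕ) 0ℓ} {b b′ D D′} →
                  b ≤ b′ → D ∣ D′ → Periodic X b D → Periodic X b′ D′
periodic-weaken b≤b′ (divides e refl) per q b′≤n = periodic-multiple per e q (≤-trans b≤b′ b′≤n)

-- Transitions of a one-counter process under shifts.

module _ {P : Set} (O : OCP P) where
  open OCP O renaming (∣Q∣ to k)
  open TransitionSystem (T O) using (_⟶_)

  State = Q × ℕ

  -- The transitions at positive counter values, extended to counter value 0 so as to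
  -- commute with shifts.
  _↝_ : Rel State 0ℓ
  (q , n) ↝ (q′ , n′) = ∃[ j ] (+ n′ ≡ + n ℤ.+ j × (q , j , q′) ∈ δ₊)

  ⟶⇒↝ : ∀ {q n s} → 0 < n → (q , n) ⟶ s → (q , n) ↝ s
  ⟶⇒↝ ()  (j , eq , inj₁ (refl , _))
  ⟶⇒↝ 0<n (j , eq , inj₂ (_ , d)) = j , eq , d

  ↝⇒⟶ : ∀ {q n s} → 0 < n → (q , n) ↝ s → (q , n) ⟶ s
  ↝⇒⟶ 0<n (j , eq , d) = j , eq , inj₂ (0<n , d)

  shift : ℕ → State → State
  shift x (q , n) = q , x + n

  ↝-shift : ∀ x {s u} → s ↝ u → shift x s ↝ shift x u
  ↝-shift x {_ , n} {_ , n′} (j , eq , d) =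
    j , trans (cong (ℤ._+_ (+ x)) eq) (sym (ℤ.+-assoc (+ x) (+ n) j)) , d

  ↝-unshift : ∀ x {s u} → shift x s ↝ shift x u → s ↝ u
  ↝-unshift x {_ , n} {_ , n′} (j , eq , d) =
    j , ∙-cancelˡ (+ x) _ _ (trans eq (ℤ.+-assoc (+ x) (+ n) j)) , d

  pred-step : ∀ n {n′} → + n′ ≡ + n ℤ.+ ℤ.-1ℤ → n ≡ suc n′
  pred-step (suc n) eq = cong suc (sym (ℤ.+-injective eq))

  ↝-slow↑ : ∀ {s u} → s ↝ u → proj₂ u ≤ suc (proj₂ s)
  ↝-slow↑ {_ , n} {_ , n′} (j , eq , d) with δ₊-range d
  ... | inj₁ refl = ≤-trans (n≤1+n n′) (≤-trans (≤-reflexive (sym (pred-step n eq))) (n≤1+n n))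
  ... | inj₂ (inj₁ refl) =
    ≤-trans (≤-reflexive (trans (ℤ.+-injective eq) (+-identityʳ n))) (n≤1+n n)
  ... | inj₂ (inj₂ refl) = ≤-reflexive (trans (ℤ.+-injective eq) (+-comm n 1))

  ↝-slow↓ : ∀ {s u} → s ↝ u → proj₂ s ≤ suc (proj₂ u)
  ↝-slow↓ {_ , n} {_ , n′} (j , eq , d) with δ₊-range d
  ... | inj₁ refl = ≤-reflexive (pred-step n eq)
  ... | inj₂ (inj₁ refl) =
    ≤-trans (≤-reflexive (sym (trans (ℤ.+-injective eq) (+-identityʳ n)))) (n≤1+n n′)
  ... | inj₂ (inj₂ refl) =
    ≤-trans (m≤m+n n 1) (≤-trans (≤-reflexive (sym (ℤ.+-injective eq))) (n≤1+n n′))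

  index : Q → Fin k
  index = Inverse.to Q-finite

  index-injective : Injective _≡_ _≡_ index
  index-injective = Injection.injective (↔⇒↣ Q-finite)

  -- Periodicity of until formulas.

  module Shifting (A : Pred State 0ℓ) (b₀ M : ℕ) (0<b₀ : 0 < b₀)
                  (A-periodic : Periodic A b₀ M) where

    open Counter index index-injective M

    S : Rel State 0ℓ
    S = Within (T O) A

    -- Steps from A in the part of T(O) with counter value at least b₀, with counter values
    -- taken relative to b₀.
    R : Rel State 0ℓ
    R s u = shift b₀ s ∈ A × s ↝ u

    exchange : ∀ x y z → x + (y + z) ≡ y + (x + z)
    exchange = solve-∀

    -- Membership in `A` is only known to survive shifts by multiples of `M`; this is why loop
    -- heights are measured in units of `M`.
    R-raise : ∀ y {s u} → R s u → R (raise y s) (raise y u)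
    R-raise y {q , l} (s∈A , s↝u) =
      subst (λ m → A (q , m)) (exchange (y * M) b₀ l)
            (to (periodic-multiple A-periodic y q (m≤m+n b₀ l)) s∈A)
      , ↝-shift (y * M) s↝u

    open Pump R (↝-slow↑ ∘ proj₂) (↝-slow↓ ∘ proj₂) R-raise

    -- A counter value on which relative paths can be placed. The two bases used are `b₀` and
    -- `D + b₀`.
    record Base (b : ℕ) : Set where
      field
        positive : 0 < b
        agrees   : ∀ s → shift b₀ s ∈ A ⇔ shift b s ∈ A

    open Base

    embed : ∀ {b} → Base b → R =[ shift b ]⇒ S
    embed {b} base {s} (s∈A , s↝u) =
      to (agrees base s) s∈A , ↝⇒⟶ (<-≤-trans (positive base) (m≤m+n b _)) (↝-shift b s↝u)

    -- From a positive relative value one step cannot fall below the base, so its target has a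
    -- relative value again.
    restrict : ∀ {b} → Base b → ∀ {q l u} → S (shift b (q , suc l)) u →
               ∃[ v ] u ≡ shift b v × R (q , suc l) v
    restrict {b} base {q} {l} {q′ , n′} (s∈A , s⟶u) =
      (q′ , n′ ∸ b) , u≡ , from (agrees base _) s∈A , ↝-unshift b (subst (_ ↝_) u≡ s↝u)
      where
      s↝u : shift b (q , suc l) ↝ (q′ , n′)
      s↝u = ⟶⇒↝ (<-≤-trans (positive base) (m≤m+n b _)) s⟶u
      u≡ : (q′ , n′) ≡ shift b (q′ , n′ ∸ b)
      u≡ = cong (q′ ,_) (sym (m+[n∸m]≡n (≤-trans (m≤m+n b l)
             (s≤s⁻¹ (subst (_≤ suc n′) (+-suc b l) (↝-slow↓ s↝u))))))

    scan : ∀ {b} → Base b → ∀ s {t} → Star S (shift b s) t →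
           (∃[ v ] t ≡ shift b v × Star R s v) ⊎
           (∃[ p ] Star R s (p , 0) × Star S (shift b (p , 0)) t)
    scan base s ε = inj₁ (s , refl , ε)
    -- At relative value 0 the next step may go below the base, so the rest of the path stays in
    -- `S`.
    scan base (q , zero) xs@(_ ◅ _) = inj₂ (q , ε , xs)
    scan base (q , suc l) (x ◅ xs)
      with v , refl , y ← restrict base x
      with scan base v xs
    ... | inj₁ (w , t≡ , ys) = inj₁ (w , t≡ , y ◅ ys)
    ... | inj₂ (p , ys , zs) = inj₂ (p , y ◅ ys , zs)

    module _ {b : ℕ} (base : Base b) where

      Drops : State → Set
      Drops s = ∃[ p ] Star R s (p , 0) × Infinite S (shift b (p , 0))

      drops-◅ : ∀ {s u} → R s u → Drops u → Drops s
      drops-◅ x (p , xs , π) = p , x ◅ xs , π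

      -- A decidable substitute for asking whether the path ever comes down: only its first `n`
      -- steps are inspected.
      watch : ∀ h n s → Infinite S (shift b s) →
              Drops s ⊎ (∃[ v ] h ≤ proj₂ v × Star R s v) ⊎
              (Σ[ ρ ∈ (ℕ → State) ] ρ 0 ≡ s ×
                (∀ {i} → i < n → R (ρ i) (ρ (suc i))) × (∀ {i} → i ≤ n → proj₂ (ρ i) < h))
      watch h n (q , l) π with h ≤? l
      watch h n       (q , l)     π | yes h≤l = inj₂ (inj₁ ((q , l) , h≤l , ε))
      watch h zero    (q , l)     π | no h≰l  =
        inj₂ (inj₂ ((λ _ → q , l) , refl , (λ ()) , λ _ → ≰⇒> h≰l))
      watch h (suc n) (q , zero)  π | no h≰l  = inj₁ (q , ε , π)
      watch h (suc n) (q , suc l) π | no h≰l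
        with _ , x , π′ ← uncons π
        with v , refl , y ← restrict base x
        with watch h n v π′
      ... | inj₁ d                                     = inj₁ (drops-◅ y d)
      ... | inj₂ (inj₁ (w , h≤w , ys))                 = inj₂ (inj₁ (w , h≤w , y ◅ ys))
      ... | inj₂ (inj₂ (ρ , refl , steps , bounded)) = inj₂ (inj₂ (ρ′ , refl , steps′ , bounded′))
        where
        ρ′ : ℕ → State
        ρ′ zero    = q , suc l
        ρ′ (suc i) = ρ i
        steps′ : ∀ {i} → i < suc n → R (ρ′ i) (ρ′ (suc i))
        steps′ {zero}  _         = y
        steps′ {suc i} (s≤s i<n) = steps i<n
        bounded′ : ∀ {i} → i ≤ suc n → proj₂ (ρ′ i) < h
        bounded′ {zero}  _         = ≰⇒> h≰l
        bounded′ {suc i} (s≤s i≤n) = bounded i≤n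

      drops-or-stays : .{{NonZero M}} → ∀ s → Infinite S (shift b s) → Drops s ⊎ Infinite R s
      -- The height `k * M + l` allows a climb of `k * M` from `l`; below that height, `k * h` steps
      -- force a repetition.
      drops-or-stays (q , l) π with watch (k * M + l) (k * (k * M + l)) (q , l) π
      ... | inj₁ d = inj₁ d
      ... | inj₂ (inj₁ ((p , m) , h≤m , xs)) =
        let r , ys , _ = Climb.cross R (↝-slow↑ ∘ proj₂) (k * M + l) (m≤n+m l _) h≤m xs
        in inj₂ (climb⇒infinite ys)
      ... | inj₂ (inj₂ (ρ , ρ₀≡ , steps , bounded)) =
        inj₂ (subst (Infinite R) ρ₀≡ (bounded⇒infinite (k * M + l) ρ steps bounded ≤-refl))

    -- Paths that never come down are moved from `b₁` to `b₂` unchanged. The others need `detour`,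
    -- which joins the original path at its arrival at the base `b₁`.
    module Transfer {b₁ b₂ : ℕ} (base₁ : Base b₁) (base₂ : Base b₂) (L : ℕ)
                    (detour : ∀ {q p l} → L ≤ l → Star R (q , l) (p , 0) →
                              Star S (shift b₂ (q , l)) (shift b₁ (p , 0))) where

      transfer-until : ∀ B → (∀ s → shift b₁ s ∈ B → shift b₂ s ∈ B) → ∀ {q l} → L ≤ l →
                       shift b₁ (q , l) ∈ Until (T O) A B → shift b₂ (q , l) ∈ Until (T O) A B
      transfer-until B B⇒B {q} {l} L≤l s∈U
        with t , xs , t∈B ← until⇒star (T O) {A} {B} s∈U
        with scan base₁ (q , l) xs
      ... | inj₁ (v , refl , ys) =
        star⇒until (T O) {A} {B} (gmap (shift b₂) (embed base₂) ys) (B⇒B v t∈B)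
      ... | inj₂ (p , ys , zs) = star⇒until (T O) {A} {B} (detour L≤l ys ◅◅ zs) t∈B

      transfer-forever : .{{NonZero M}} → ∀ {q l} → L ≤ l →
                         shift b₁ (q , l) ∈ Forever (T O) A → shift b₂ (q , l) ∈ Forever (T O) A
      transfer-forever {q} {l} L≤l s∈F
        with drops-or-stays base₁ (q , l) (forever⇒infinite (T O) {A} s∈F)
      ... | inj₁ (p , ys , π) = infinite⇒forever (T O) {A} (prepend (detour L≤l ys) π)
      ... | inj₂ π = infinite⇒forever (T O) {A} (map-infinite (shift b₂) (embed base₂) π)

    module _ (N : ℕ) .{{_ : NonZero M}} .{{_ : NonZero N}}
             (height∣N : ∀ (c : Fin k) → suc (toℕ c) ∣ N) where

      private
        D = N * M
        L = k * N * (k * M)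

      low : Base b₀
      low = record { positive = 0<b₀ ; agrees = λ _ → ⇔-id _ }

      high : Base (D + b₀)
      high = record
        { positive = <-≤-trans 0<b₀ (m≤n+m b₀ D)
        ; agrees   = λ (q , l) → subst (λ m → A (q , b₀ + l) ⇔ A (q , m)) (sym (+-assoc D b₀ l))
                       (periodic-multiple A-periodic N q (m≤m+n b₀ l))
        }

      kM≤L : Q → k * M ≤ L
      kM≤L q = m≤n*m (k * M) (k * N) {{m*n≢0 k N {{Fin.nonZeroIndex (index q)}}}}

      -- The path lies over the lower base: `D + b₀ + l` is read as `b₀` plus the relative value
      -- `N * M + l`.
      insertion : ∀ {q p l} → L ≤ l → Star R (q , l) (p , 0) →
                  Star S (shift (D + b₀) (q , l)) (shift b₀ (p , 0))
      insertion {q} {p} {l} L≤l xs =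
        subst (λ m → Star S (q , m) (shift b₀ (p , 0)))
              (trans (exchange b₀ D l) (sym (+-assoc D b₀ l)))
              (gmap (shift b₀) (embed low) (insert-loops N height∣N (≤-trans (kM≤L q) L≤l) xs))

      -- Again over the lower base: ending at relative value `N * M` means arriving at `D + b₀`,
      -- where the original path came down.
      deletion : ∀ {q p l} → L ≤ l → Star R (q , l) (p , 0) →
                 Star S (shift b₀ (q , l)) (shift (D + b₀) (p , 0))
      deletion {q} {p} {l} L≤l xs =
        subst (λ m → Star S (shift b₀ (q , l)) (p , m))
              (trans (+-comm b₀ D) (sym (+-identityʳ (D + b₀))))
              (gmap (shift b₀) (embed low) (delete-loops N height∣N L≤l xs))

      module Up   = Transfer low high L insertion
      module Down = Transfer high low L deletion

      periodic-from-shift : ∀ {X : Pred State 0ℓ} →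
        (∀ {q l} → L ≤ l → shift b₀ (q , l) ∈ X ⇔ shift (D + b₀) (q , l) ∈ X) →
        Periodic X (b₀ + L) D
      periodic-from-shift {X} iff q {n} b≤n =
        subst (λ m → X (q , m) ⇔ X (q , D + m)) (m+[n∸m]≡n (≤-trans (m≤m+n b₀ L) b≤n))
          (subst (λ m → X (q , b₀ + l) ⇔ X (q , m)) (+-assoc D b₀ l)
            (iff (m+n≤o⇒m≤o∸n L (≤-trans (≤-reflexive (+-comm L b₀)) b≤n))))
        where l = n ∸ b₀

      module _ {B : Pred State 0ℓ} (B-periodic : Periodic B b₀ D) where

        B-agrees : ∀ s → shift b₀ s ∈ B ⇔ shift (D + b₀) s ∈ B
        B-agrees (q , l) = subst (λ m → B (q , b₀ + l) ⇔ B (q , m)) (sym (+-assoc D b₀ l))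
                             (B-periodic q (m≤m+n b₀ l))

        -- `B` is tested only at the last state, which is either kept or shifted by `D`, so period
        -- `D` suffices for it. `A` must survive shifts by single loops and has the finer period
        -- `M`.
        until-periodic : Periodic (Until (T O) A B) (b₀ + L) D
        until-periodic = periodic-from-shift λ L≤l →
          mk⇔ (Up.transfer-until B (to ∘ B-agrees) L≤l)
              (Down.transfer-until B (from ∘ B-agrees) L≤l)

        weak-until-periodic : Periodic (λ s → Until (T O) A B s ⊎ Forever (T O) A s) (b₀ + L) D
        weak-until-periodic = periodic-from-shift λ L≤l →
          mk⇔ (map-⊎ (Up.transfer-until B (to ∘ B-agrees) L≤l) (Up.transfer-forever L≤l))
              (map-⊎ (Down.transfer-until B (from ∘ B-agrees) L≤l) (Down.transfer-forever L≤l))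

-- Least common multiples of lists.

∣LCM : ∀ {x xs} → x ∈ˡ xs → x ∣ LCM xs
∣LCM {xs = x ∷ xs} (here refl)  = m∣lcm[m,n] x (LCM xs)
∣LCM {xs = x ∷ xs} (there x∈xs) = ∣-trans (∣LCM x∈xs) (n∣lcm[m,n] x (LCM xs))

-- The least common multiple divides `m * n`, and 0 divides only 0.
lcm-nonZero : ∀ m n → .{{NonZero m}} → .{{NonZero n}} → NonZero (lcm m n)
lcm-nonZero m n = ≢-nonZero λ lcm≡0 →
  ≢-nonZero⁻¹ (m * n) {{m*n≢0 m n}}
    (0∣⇒≡0 (subst (_∣ m * n) lcm≡0 (lcm-least {m} {n} (m∣m*n n) (n∣m*n m))))

LCM-nonZero : ∀ f n → (∀ i → NonZero (f i)) → NonZero (LCM (applyUpTo f n))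
LCM-nonZero f zero    nz = _
LCM-nonZero f (suc n) nz = lcm-nonZero (f 0) _ {{nz 0}} {{LCM-nonZero (f ∘ suc) n (nz ∘ suc)}}

-- The bound and the induction on formulas.

module _ {P : Set} (O : OCP P) where
  open OCP O renaming (∣Q∣ to k)
  open TransitionSystem (T O) using (_⟶_)

  K = LCM [1⋯ k ]

  instance
    K-nonZero : NonZero K
    K-nonZero = LCM-nonZero suc k _

  height∣K : ∀ (c : Fin k) → suc (toℕ c) ∣ K
  height∣K c = ∣LCM (∈-applyUpTo⁺ suc (toℕ<n c))

  bound : ℕ → ℕ → ℕ
  bound s d = 2 * s * k ^ 2 * K ^ d

  K^-∣ : ∀ {d d′} → d ≤ d′ → K ^ d ∣ K ^ d′
  K^-∣ {d} {d′} d≤d′ =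
    subst (λ x → K ^ d ∣ K ^ x) (m+[n∸m]≡n d≤d′)
      (subst (K ^ d ∣_) (sym (^-distribˡ-+-* K d (d′ ∸ d))) (m∣m*n _))

  bound-mono : ∀ {s s′ d d′} → s ≤ s′ → d ≤ d′ → bound s d ≤ bound s′ d′
  bound-mono s≤s′ d≤d′ =
    *-mono-≤ (*-monoˡ-≤ (k ^ 2) (*-monoʳ-≤ 2 s≤s′)) (^-monoʳ-≤ K d≤d′)

  bound-suc : ∀ s d → bound (s + 1) d ≡ bound s d + 2 * k ^ 2 * K ^ d
  bound-suc s d = distribute s (k ^ 2) (K ^ d)
    where
    distribute : ∀ s x y → 2 * (s + 1) * x * y ≡ 2 * s * x * y + 2 * x * y
    distribute = solve-∀

  -- The `suc` turns the strict bound of the theorem into the non-strict threshold of `Periodic`.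
  PeriodicFormula : CTL P → Set
  PeriodicFormula φ = Periodic (⟦ T O ⟧ φ) (suc (bound (size φ) (lud φ))) (K ^ lud φ)

  weaken : ∀ φ s d → size φ ≤ s → lud φ ≤ d → PeriodicFormula φ →
           Periodic (⟦ T O ⟧ φ) (suc (bound s d)) (K ^ d)
  weaken φ s d size≤s lud≤d = periodic-weaken (s≤s (bound-mono size≤s lud≤d)) (K^-∣ lud≤d)

  -- A step lowers the counter by at most one, so raising the threshold by one keeps every successor
  -- above the old threshold.
  next-periodic : ∀ {X : Pred (State O) 0ℓ} {b D} → Periodic X (suc b) D →
                  Periodic (λ s → ∃[ s′ ] (s′ ∈ X × s ⟶ s′)) (suc (suc b)) D
  next-periodic {X} {b} {D} per q {suc n} (s≤s b<n) = mk⇔ forth back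
    where
    forth : ∃[ s′ ] (s′ ∈ X × (q , suc n) ⟶ s′) → ∃[ s′ ] (s′ ∈ X × (q , D + suc n) ⟶ s′)
    forth ((q′ , n′) , s′∈X , x) =
      (q′ , D + n′) , to (per q′ (≤-trans b<n (s≤s⁻¹ (↝-slow↓ O s↝s′)))) s′∈X ,
      ↝⇒⟶ O (<-≤-trans z<s (m≤n+m (suc n) D)) (↝-shift O D s↝s′)
      where s↝s′ = ⟶⇒↝ O z<s x
    back : ∃[ s′ ] (s′ ∈ X × (q , D + suc n) ⟶ s′) → ∃[ s′ ] (s′ ∈ X × (q , suc n) ⟶ s′)
    back ((q′ , m) , s′∈X , x) =
      (q′ , n′) , from (per q′ (≤-trans b<n n≤n′)) (subst (λ m → X (q′ , m)) m≡ s′∈X) ,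
      ↝⇒⟶ O z<s s↝s′
      where
      n′ = m ∸ D
      0<D+n : 0 < D + suc n
      0<D+n = <-≤-trans z<s (m≤n+m (suc n) D)
      D+n≤m : D + n ≤ m
      D+n≤m = s≤s⁻¹ (subst (_≤ suc m) (+-suc D n) (↝-slow↓ O (⟶⇒↝ O 0<D+n x)))
      m≡ : m ≡ D + n′
      m≡ = sym (m+[n∸m]≡n (≤-trans (m≤m+n D n) D+n≤m))
      n≤n′ : n ≤ n′
      n≤n′ = +-cancelˡ-≤ D n n′ (subst (D + n ≤_) m≡ D+n≤m)
      s↝s′ : _↝_ O (q , suc n) (q′ , n′)
      s↝s′ = ↝-unshift O D (subst (λ m → _↝_ O (q , D + suc n) (q′ , m)) m≡ (⟶⇒↝ O 0<D+n x))

  module UntilStep (φ ψ : CTL P) (φ-periodic : PeriodicFormula φ)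
                   (ψ-periodic : PeriodicFormula ψ) where

    s = size φ + size ψ
    d₁ = lud φ
    d₂ = lud ψ
    d = (d₁ + 1) ⊔ d₂
    e = d ∸ (d₁ + 1)
    M = K ^ d₁
    -- Since `d` is at least `d₁ + 1`, the quotient of `K ^ d` by `M` still contains a factor `K`,
    -- so every loop height divides it.
    N = K * K ^ e

    NM≡K^d : N * M ≡ K ^ d
    NM≡K^d = trans (rearrange K (K ^ e) M)
      (trans (cong (_* K ^ e) (sym (^-distribˡ-+-* K d₁ 1)))
        (trans (sym (^-distribˡ-+-* K (d₁ + 1) e)) (cong (K ^_) (m+[n∸m]≡n (m≤m⊔n (d₁ + 1) d₂)))))
      where
      rearrange : ∀ x y z → x * y * z ≡ z * (x * 1) * y
      rearrange = solve-∀

    instance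
      M-nonZero : NonZero M
      M-nonZero = m^n≢0 K d₁
      N-nonZero : NonZero N
      N-nonZero = m*n≢0 K (K ^ e) {{K-nonZero}} {{m^n≢0 K e}}

    -- The descent needed for deletion has length `k ^ 2 * K ^ d`, and the `+ 1` in the size of an
    -- until formula adds `2 * k ^ 2 * K ^ d` to the bound.
    room : suc (bound s d) + k * N * (k * M) ≤ suc (bound (s + 1) d)
    room = s≤s (begin
      bound s d + k * N * (k * M)         ≡⟨ cong (_+_ (bound s d)) (square k N M) ⟩
      bound s d + k ^ 2 * (N * M)         ≡⟨ cong (λ x → bound s d + k ^ 2 * x) NM≡K^d ⟩
      bound s d + k ^ 2 * K ^ d           ≤⟨ +-monoʳ-≤ (bound s d)
                                               (*-monoˡ-≤ (K ^ d) (m≤n*m (k ^ 2) 2)) ⟩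
      bound s d + 2 * k ^ 2 * K ^ d       ≡⟨ bound-suc s d ⟨
      bound (s + 1) d                     ∎)
      where
      open ≤-Reasoning
      square : ∀ k N M → k * N * (k * M) ≡ k * (k * 1) * (N * M)
      square = solve-∀

    open Shifting O (⟦ T O ⟧ φ) (suc (bound s d)) M z<s
           (periodic-weaken (s≤s (bound-mono (m≤m+n (size φ) (size ψ))
                                              (≤-trans (m≤m+n d₁ 1) (m≤m⊔n (d₁ + 1) d₂))))
                            ∣-refl φ-periodic)

    enlarge : {X : Pred (State O) 0ℓ} → Periodic X (suc (bound s d) + k * N * (k * M)) (N * M) →
              Periodic X (suc (bound (s + 1) d)) (K ^ d)
    enlarge {X} = periodic-weaken {X = X} room (subst (N * M ∣_) NM≡K^d ∣-refl)

    height∣N : ∀ (c : Fin k) → suc (toℕ c) ∣ N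
    height∣N c = ∣-trans (height∣K c) (m∣m*n (K ^ e))

    ψ-periodic′ : Periodic (⟦ T O ⟧ ψ) (suc (bound s d)) (N * M)
    ψ-periodic′ = subst (Periodic (⟦ T O ⟧ ψ) (suc (bound s d))) (sym NM≡K^d)
                    (weaken ψ s d (m≤n+m (size ψ) (size φ)) (m≤n⊔m (d₁ + 1) d₂) ψ-periodic)

    U-periodic : PeriodicFormula (∃ φ U ψ)
    U-periodic = enlarge {⟦ T O ⟧ (∃ φ U ψ)} (until-periodic N height∣N ψ-periodic′)

    WU-periodic : PeriodicFormula (∃ φ WU ψ)
    WU-periodic = enlarge {⟦ T O ⟧ (∃ φ WU ψ)} (weak-until-periodic N height∣N ψ-periodic′)

  formula-periodic : ∀ φ → PeriodicFormula φ
  formula-periodic (prop p) q _ = ⇔-id _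
  formula-periodic (¬′ φ) q b≤n =
    ¬-cong-⇔ (weaken φ (size φ + 1) (lud φ) (m≤m+n (size φ) 1) ≤-refl (formula-periodic φ) q b≤n)
  formula-periodic (φ ∧′ ψ) q b≤n =
    weaken φ s d (≤-trans (m≤m+n (size φ) (size ψ)) (m≤m+n _ 1)) (m≤m⊔n (lud φ) (lud ψ))
           (formula-periodic φ) q b≤n
    ×-⇔
    weaken ψ s d (≤-trans (m≤n+m (size ψ) (size φ)) (m≤m+n _ 1)) (m≤n⊔m (lud φ) (lud ψ))
           (formula-periodic ψ) q b≤n
    where
    s = size φ + size ψ + 1
    d = lud φ ⊔ lud ψ
  formula-periodic (∃X φ) q b≤n =
    next-periodic (formula-periodic φ) q (≤-trans (s≤s larger) b≤n)
    where
    instance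
      k-nonZero : NonZero k
      k-nonZero = Fin.nonZeroIndex (index O q)
    -- One more unit of size must raise the bound by at least one; `k` is positive because `q`
    -- exists.
    larger : suc (bound (size φ) (lud φ)) ≤ bound (size φ + 1) (lud φ)
    larger = subst₂ _≤_ (+-comm _ 1) (sym (bound-suc (size φ) (lud φ)))
      (+-monoʳ-≤ (bound (size φ) (lud φ))
        (*-mono-≤ (*-mono-≤ (z<s {1}) (m^n>0 k 2)) (m^n>0 K (lud φ))))
  formula-periodic (∃ φ U ψ)  = UntilStep.U-periodic φ ψ (formula-periodic φ) (formula-periodic ψ)
  formula-periodic (∃ φ WU ψ) = UntilStep.WU-periodic φ ψ (formula-periodic φ) (formula-periodic ψ)

  formula-periodic-mod : ∀ φ q {n n′} → n > bound (size φ) (lud φ) → n ≤ n′ →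
                         n ≡ n′ mod (K ^ lud φ) →
                         ((q , n) ∈ ⟦ T O ⟧ φ) ⇔ ((q , n′) ∈ ⟦ T O ⟧ φ)
  formula-periodic-mod φ q {n} {n′} b<n n≤n′ D∣
    with subst (K ^ lud φ ∣_) (m≤n⇒∣m-n∣≡n∸m n≤n′) D∣
  ... | divides e n′∸n≡ =
    subst (λ m → (q , n) ∈ ⟦ T O ⟧ φ ⇔ (q , m) ∈ ⟦ T O ⟧ φ)
          (trans (cong (_+ n) (sym n′∸n≡)) (m∸n+n≡m n≤n′))
          (periodic-multiple {X = ⟦ T O ⟧ φ} (formula-periodic φ) e q b<n)

theorem4p1 :
    (P : Set) → P ↣ ℕ → (O : OCP P) →
    let k = OCP.∣Q∣ O
        K = LCM [1⋯ k ]
        K[_] = λ (φ : CTL P) → K ^ lud φ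
    in
    (φ : CTL P) (q : OCP.Q O) (n n′ : ℕ) →
    n > 2 * size φ * k ^ 2 * K[ φ ] →
    n′ > 2 * size φ * k ^ 2 * K[ φ ] →
    n ≡ n′ mod K[ φ ] →
    ((q , n) ∈ ⟦ T O ⟧ φ) ⇔ ((q , n′) ∈ ⟦ T O ⟧ φ)
theorem4p1 P _ O φ q n n′ b<n b<n′ n≡n′ with ≤-total n n′
... | inj₁ n≤n′ = formula-periodic-mod O φ q b<n n≤n′ n≡n′
... | inj₂ n′≤n = ⇔-sym (formula-periodic-mod O φ q b<n′ n′≤n
                           (subst (_ ∣_) (∣-∣-comm n n′) n≡n′))
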